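{- Let $w$ be a pattern over a finite alphabet $\mathcal{A}$ and let $\Gamma=(Q,o,F,\alpha,\delta,\gamma)$ be a $w$-matching machine. If a text $t$ follows an iid model $\pi$ and $\Gamma$ is non-redundant (resp. standard), then the sequence of states parsed by the generic algorithm on the input $(\Gamma,t)$ follows a Markov model $M=(\pi_M,\delta_M)$, where for all states $q$ and $q'$: - $\pi_M(q)=1$ if $q=o$, and $\pi_M(q)=0$ otherwise; - $\delta_M(q,q')=\sum_{x:\,\delta(q,x)=q'}\pi(x)$ if $\Gamma$ is not redundant; - $\delta_M(q,q')=\dfrac{\sum_{x:\,\delta(q,x)=q'}\pi(x)}{\sum_{x:\,\delta(q,x)\neq\odot}\pi(x)}$ if $\Gamma$ is standard, where $\odot$ is the sink state of $\Gamma$.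
   Context: Words (texts, patterns) are finite sequences over $\mathcal{A}$, indexed from $0$; $|v|$ is the length of $v$. **Matching machines.** A $w$-matching machine is a 6-tuple $\Gamma=(Q,o,F,\alpha,\delta,\gamma)$: $Q$ a finite set of states, $o\in Q$ the initial state, $F\subset Q$ the pre-match states, $\alpha:Q\to\mathbb{N}$ the next-position-to-check function, with $\alpha(q)<|w|$ for all $q\in F$, $\delta:Q\times\mathcal{A}\to Q$ the transition function, $\gamma:Q\times\mathcal{A}\to\mathbb{N}$ the shift function. By convention the set of states of a matching machine always contains a sink state $\odot$ with $\delta(\odot,x)=\odot$ and $\gamma(\odot,x)=0$ for all $x\in\mathcal A$. The order of $\Gamma$ is $O_\Gamma=\max_{q\in Q}\alpha(q)$. **Generic algorithm** on $(\Gamma,t)$: start with $(q,p)=(o,0)$; while $p\le|t|-|w|$: if $q\in F$ and $t_{p+\alpha(q)}=w_{\alpha(q)}$, report an occurrence at position $p$; then replace $(q,p)$ by $(\delta(q,t_{p+\alpha(q)}),\,p+\gamma(q,t_{p+\alpha(q)}))$. The sequence of states parsed is the sequence of values of $q$ at the beginning of the successive iterations; each iteration accesses the text position $p+\alpha(q)$. $\Gamma$ is *redundant* if there is a text $t$ for which a position is accessed more than once during the execution of the generic algorithm on $(\Gamma,t)$; otherwise it is non-redundant. Standing assumption: every state except possibly the sink is reachable, i.e. is the current state at some iteration for some text. **Standard machines.** $R_n$ is the set of partial functions from $\{0,\dots,n\}$ to $\mathcal{A}$, seen as sets of pairs; for $H\in R_n$, $\mathbf f(H)$ is its domain and, for $k\ge0$,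 the $k$-shifted of $H$ is $\{(u-k,y): (u,y)\in H,\ u\ge k\}$. The full memory expansion $\widehat\Gamma$ of $\Gamma$ is the $w$-matching machine with states $(q,H)\in Q\times R_{O_\Gamma}$ (together with a sink), initial state $(o,\emptyset)$, pre-match states $F\times R_{O_\Gamma}$, next position to check $\alpha(q)$ and shift $\gamma(q,x)$ at $(q,H)$, and transition on $x$ from $(q,H)$: to $(\delta(q,x),H')$, with $H'$ the $\gamma(q,x)$-shifted of $H\cup\{(\alpha(q),x)\}$, if $\alpha(q)\notin\mathbf f(H)$ or $(\alpha(q),x)\in H$; to the sink if $(\alpha(q),a)\in H$ for some $a\ne x$; its unreachable states other than the sink are then removed. $\Gamma$ is *standard* if its set of states has the same cardinality as that of $\widehat\Gamma$ or, equivalently, if each state $q$ of $\Gamma$ appears in a unique state $(q,H)$ of $\widehat\Gamma$ (the sinks being set apart). **Models.** An iid model is a probability distribution $\pi$ on $\mathcal{A}$; under it a text $t$ has probability $\prod_{i=0}^{|t|-1}\pi(t_i)$. A Markov model $(\pi_M,\delta_M)$ on $Q$ consists of an initial distribution $\pi_M$ on $Q$ and transition probabilities $\delta_M(q,q')$; under it a sequence $u_0\dots u_m$ has probability $\pi_M(u_0)\prod_{i=1}^{m}\delta_M(u_{i-1},u_i)$.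
   Formalization: In the standard case it is assumed that from each state q any letter contradicting the memory H of q leads to the sink ⊙ of Γ, and the formula for δ_M(q,q') is asserted only for q' ≠ ⊙ and nonzero denominator; otherwise the claim fails or is undefined. -}

module Defs where

open import Algebra.Bundles using (CommutativeRing)
open import Algebra.Definitions.RawMonoid using () renaming (sum to monoidSum)
open import Data.Bool.Base using (Bool; true; false; T; if_then_else_)
open import Data.Fin.Base using (Fin; toℕ; fromℕ<)
import Data.Fin.Properties as Fin
open import Data.List.Base using (allFin) renaming (map to mapList)
open import Data.List.Extrema.Nat using (max; xs≤max)
open import Data.List.Membership.Propositional.Properties using (∈-map⁺; ∈-allFin)
import Data.List.Relation.Unary.All as All
open import Data.Maybe.Base using (Maybe; just; nothing; _>>=_)
  renaming (map to mapMaybe)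
open import Data.Maybe using (Is-just)
import Data.Maybe.Properties as Maybe
open import Data.Nat.Base using (ℕ; zero; suc; _+_; _≤_; _<_; s≤s)
open import Data.Nat.Properties using (_≤?_)
open import Data.Product.Base using (Σ; ∃-syntax; _×_; _,_; proj₁)
open import Data.Sum.Base using (_⊎_)
open import Data.Vec.Base using (Vec; []; _∷_; lookup; tabulate; replicate; foldr′; _[_]≔_)
  renaming (map to mapVec)
import Data.Vec.Properties as Vec
open import Function.Base using (id)
open import Function.Bundles using (Bijection)
open import Level using (Level; _⊔_; 0ℓ) renaming (suc to lsuc)
open import Relation.Binary.Bundles using (Setoid)
import Relation.Binary.Construct.On as On
open import Relation.Binary.Core using (Rel)
open import Relation.Binary.PropositionalEquality.Core using (_≡_; _≢_; refl)
import Relation.Binary.PropositionalEquality.Properties as ≡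
open import Relation.Binary.Structures using (IsDecTotalOrder)
open import Relation.Nullary.Decidable.Core using (Dec; does)
open import Relation.Nullary.Negation.Core using (¬_)

private
  variable
    c ℓ₁ ℓ₂ : Level
    σ k ℓ n : ℕ

------------------------------------------------------------------------
-- Words

-- The alphabet is Fin σ; the index is the length of the word.
Word : ℕ → ℕ → Set
Word σ n = Vec (Fin σ) n

infix 8 _‼_

_‼_ : ∀ {a} {A : Set a} → Vec A n → ℕ → Maybe A
[]       ‼ _     = nothing
(x ∷ xs) ‼ zero  = just x
(x ∷ xs) ‼ suc i = xs ‼ i

------------------------------------------------------------------------
-- Matching machines

record MatchingMachine {σ ℓ : ℕ} (w : Word σ ℓ) (Q : Set) : Set where
  field
    initial  : Q
    preMatch : Q → Bool
    α        : Q → ℕ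
    α<|w|    : ∀ q → T (preMatch q) → α q < ℓ
    δ        : Q → Fin σ → Q
    γ        : Q → Fin σ → ℕ
    sink     : Q
    δ-sink   : ∀ x → δ sink x ≡ sink
    γ-sink   : ∀ x → γ sink x ≡ 0

open MatchingMachine public

order : {w : Word σ ℓ} → MatchingMachine w (Fin k) → ℕ
order {k = k} Γ = max 0 (mapList (α Γ) (allFin k))

α<1+order : {w : Word σ ℓ} (Γ : MatchingMachine w (Fin k)) → ∀ q → α Γ q < suc (order Γ)
α<1+order {k = k} Γ q =
  s≤s (All.lookup (xs≤max 0 (mapList (α Γ) (allFin k))) (∈-map⁺ (α Γ) (∈-allFin q)))

------------------------------------------------------------------------
-- The generic algorithm

module _ {w : Word σ ℓ} {Q : Set} (Γ : MatchingMachine w Q) where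

  -- p ≤ |t| - |w|, without truncated subtraction.
  admit : ℕ → Q × ℕ → Maybe (Q × ℕ)
  admit n (q , p) = if does (p + ℓ ≤? n) then just (q , p) else nothing

  -- Outside F the position p + α q may lie beyond the end of the text; the
  -- algorithm then stops.  Reporting an occurrence, which is the only use of
  -- F and of the letters of w, has no effect on (q , p) and is left out.
  update : Word σ n → Q × ℕ → Maybe (Q × ℕ)
  update t (q , p) = mapMaybe (λ x → δ Γ q x , p + γ Γ q x) (t ‼ (p + α Γ q))

  -- The value of (q , p) at the beginning of the i-th iteration (from 0), if
  -- there is such an iteration.
  iteration : Word σ n → ℕ → Maybe (Q × ℕ)
  iteration {n = n} t zero    = admit n (initial Γ , 0)
  iteration {n = n} t (suc i) = iteration t i >>= update t >>= admit n

  state : Word σ n → ℕ → Maybe Q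
  state t i = mapMaybe proj₁ (iteration t i)

  accessed : Word σ n → ℕ → Maybe ℕ
  accessed t i = mapMaybe (λ (q , p) → p + α Γ q) (iteration t i)

  -- The first m + 1 states parsed.
  parsed : Word σ n → (m : ℕ) → Vec (Maybe Q) (suc m)
  parsed t m = tabulate (λ i → state t (toℕ i))

  Redundant : Set
  Redundant = ∃[ n ] Σ (Word σ n) λ t → ∃[ i ] ∃[ j ] ∃[ s ]
    i < j × accessed t i ≡ just s × accessed t j ≡ just s

  Reachable : Q → Set
  Reachable q = ∃[ n ] Σ (Word σ n) λ t → ∃[ i ] state t i ≡ just q

  AllReachable : Set
  AllReachable = ∀ q → q ≢ sink Γ → Reachable q

------------------------------------------------------------------------
-- Full memory expansion and standard machines

-- R_n: the partial functions from {0,…,n} to the alphabet.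
Memory : ℕ → ℕ → Set
Memory σ n = Vec (Maybe (Fin σ)) (suc n)

shifted : ℕ → Memory σ n → Memory σ n
shifted k H = tabulate (λ u → (H ‼ (toℕ u + k)) >>= id)

module _ {w : Word σ ℓ} (Γ : MatchingMachine w (Fin k)) where

  -- The sink of the expansion is nothing; it is distinct from every
  -- (sink Γ , H).
  ExpandedState : Set
  ExpandedState = Maybe (Fin k × Memory σ (order Γ))

  slot : Fin k → Fin (suc (order Γ))
  slot q = fromℕ< (α<1+order Γ q)

  next : Fin k → Memory σ (order Γ) → Fin σ → ExpandedState
  next q H x = just (δ Γ q x , shifted (γ Γ q x) (H [ slot q ]≔ just x))

  expansionδ : ExpandedState → Fin σ → ExpandedState
  expansionδ nothing        x = nothing
  expansionδ (just (q , H)) x with lookup H (slot q)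
  ... | nothing = next q H x
  ... | just a  = if does (a Fin.≟ x) then next q H x else nothing

  -- Unreachable states are removed in ExpansionStates below.
  expansion : MatchingMachine w ExpandedState
  expansion = record
    { initial  = just (initial Γ , replicate _ nothing)
    ; preMatch = λ { nothing → false ; (just (q , _)) → preMatch Γ q }
    ; α        = λ { nothing → 0     ; (just (q , _)) → α Γ q }
    ; α<|w|    = λ { nothing ()      ; (just (q , _)) → α<|w| Γ q }
    ; δ        = expansionδ
    ; γ        = λ { nothing _ → 0   ; (just (q , _)) x → γ Γ q x }
    ; sink     = nothing
    ; δ-sink   = λ _ → refl
    ; γ-sink   = λ _ → refl
    }

  -- Compared on the underlying state only, so that distinct proofs of
  -- reachability do not count as distinct states.
  ExpansionStates : Setoid 0ℓ 0ℓ
  ExpansionStates =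
    On.setoid (≡.setoid ExpandedState)
      (proj₁ {B = λ s → s ≡ sink expansion ⊎ Reachable expansion s})

  -- The set of states of Γ has the same cardinality as that of its expansion.
  Standard : Set
  Standard = Bijection (≡.setoid (Fin k)) ExpansionStates

  -- Equality of cardinalities says nothing about δ Γ q x for a letter x that
  -- contradicts the memory of q, since that transition is never taken.  This
  -- condition sends it to the sink of Γ, as it is in the expansion.
  SinkCompatible : Set
  SinkCompatible = ∀ q H x → Reachable expansion (just (q , H)) →
    δ expansion (just (q , H)) x ≡ sink expansion → δ Γ q x ≡ sink Γ

------------------------------------------------------------------------
-- Ordered fields

-- The real numbers are an instance.
record OrderedField c ℓ₁ ℓ₂ : Set (lsuc (c ⊔ ℓ₁ ⊔ ℓ₂)) where
  field
    commutativeRing : CommutativeRing c ℓ₁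

  open CommutativeRing commutativeRing public
    renaming (_+_ to infixl 6 _+ᶠ_; _*_ to infixl 7 _*ᶠ_)

  infix  4 _≤ᶠ_
  infix  8 _⁻¹
  infixl 7 _÷_

  field
    _≤ᶠ_            : Rel Carrier ℓ₂
    isDecTotalOrder : IsDecTotalOrder _≈_ _≤ᶠ_
    +-monoˡ-≤       : ∀ z {x y} → x ≤ᶠ y → x +ᶠ z ≤ᶠ y +ᶠ z
    *-nonneg        : ∀ {x y} → 0# ≤ᶠ x → 0# ≤ᶠ y → 0# ≤ᶠ x *ᶠ y
    0≉1             : ¬ (0# ≈ 1#)
    _⁻¹             : Carrier → Carrier
    *-inverseʳ      : ∀ x → ¬ (x ≈ 0#) → x *ᶠ x ⁻¹ ≈ 1#

  _÷_ : Carrier → Carrier → Carrier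
  x ÷ y = x *ᶠ y ⁻¹

  ∑ : ∀ {n} → (Fin n → Carrier) → Carrier
  ∑ = monoidSum +-rawMonoid

  indicator : ∀ {p} {P : Set p} → Dec P → Carrier → Carrier
  indicator P? x = if does P? then x else 0#

------------------------------------------------------------------------
-- Probabilistic models

module Models (𝔽 : OrderedField c ℓ₁ ℓ₂) where
  open OrderedField 𝔽

  record Distribution (n : ℕ) : Set (c ⊔ ℓ₁ ⊔ ℓ₂) where
    field
      mass   : Fin n → Carrier
      nonneg : ∀ i → 0# ≤ᶠ mass i
      total  : ∑ mass ≈ 1#

  open Distribution public

  textProbability : Distribution σ → Word σ n → Carrier
  textProbability π t = foldr′ _*ᶠ_ 1# (mapVec (mass π) t)

  ∑words : ∀ n → (Word σ n → Carrier) → Carrier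
  ∑words zero    f = f []
  ∑words (suc n) f = ∑ λ x → ∑words n (λ t → f (x ∷ t))

  probability : ∀ {p} → Distribution σ → ∀ n {P : Word σ n → Set p} →
                (∀ t → Dec (P t)) → Carrier
  probability π n P? = ∑words n (λ t → indicator (P? t) (textProbability π t))

  record MarkovModel (k : ℕ) : Set (c ⊔ ℓ₁ ⊔ ℓ₂) where
    field
      π-M         : Distribution k
      transitions : Fin k → Distribution k

    δ-M : Fin k → Fin k → Carrier
    δ-M q = mass (transitions q)

    pathWeight : ∀ {m} → Fin k → Vec (Fin k) m → Carrier
    pathWeight q []       = 1#
    pathWeight q (r ∷ rs) = δ-M q r *ᶠ pathWeight r rs

    sequenceProbability : ∀ {m} → Vec (Fin k) (suc m) → Carrier
    sequenceProbability (q ∷ qs) = mass π-M q *ᶠ pathWeight q qs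

  open MarkovModel public

  module _ {w : Word σ ℓ} (Γ : MatchingMachine w (Fin k)) where

    ParsesFirst : ∀ {m} → Vec (Fin k) (suc m) → Word σ n → Set
    ParsesFirst {m = m} u t = parsed Γ t m ≡ mapVec just u

    parsesFirst? : ∀ {m} (u : Vec (Fin k) (suc m)) (t : Word σ n) → Dec (ParsesFirst u t)
    parsesFirst? u t = Vec.≡-dec (Maybe.≡-dec Fin._≟_) _ _

    -- The algorithm performs at least m + 1 iterations on all texts of length n.
    LongEnough : ℕ → ℕ → Set
    LongEnough m n = ∀ (t : Word σ n) → Is-just (iteration Γ t m)

    -- Texts being finite, the law of the sequence of states is expressed by
    -- its finite-dimensional marginals: for texts of any length that cannot
    -- interrupt the algorithm during its first m iterations, the first m + 1
    -- states have the law of the model.  All large lengths are of this kind.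
    StatesFollow : Distribution σ → MarkovModel k → Set ℓ₁
    StatesFollow π M = ∀ m →
      (∃[ N ] ∀ n → N ≤ n → LongEnough m n) ×
      (∀ n → LongEnough m n → ∀ (u : Vec (Fin k) (suc m)) →
         probability π n (parsesFirst? u) ≈ sequenceProbability M u)

    StartsAtInitial : MarkovModel k → Set ℓ₁
    StartsAtInitial M = ∀ q → mass (π-M M) q ≈ indicator (q Fin.≟ initial Γ) 1#

    -- ∑ of π(x) over the x with δ(q,x) = q'.
    weightTo : Distribution σ → Fin k → Fin k → Carrier
    weightTo π q q' = ∑ λ x → indicator (δ Γ q x Fin.≟ q') (mass π x)

    -- ∑ of π(x) over the x with δ(q,x) ≠ ⊙.
    weightOffSink : Distribution σ → Fin k → Carrier
    weightOffSink π q = ∑ λ x →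
      if does (δ Γ q x Fin.≟ sink Γ) then 0# else mass π x

{-# OPTIONS --safe #-}
module Submission where

-- A partial word K records the letters already read.  Given K, the unread
-- letters are still independent with law π and the read ones are fixed, so the
-- next letter has the law letterLaw π (K s) at the position s about to be read.
-- Position p of the text being slot 0 of the memory H of the expansion,
-- K (p + α q) is the content of H at α q, and the chain is Markov as soon as
-- this content depends on q only.  Non-redundancy makes it always empty;
-- standardness makes H a function of q, by the pigeonhole principle, and
-- excludes the sink from all runs.

open import Defs
import Algebra.Properties.Ring as RingProperties
import Algebra.Properties.Semiring.Sum as SemiringSum
open import Data.Bool.Base using (true; false; if_then_else_)
open import Data.Empty using (⊥-elim)
open import Data.Fin.Base using (Fin; zero; suc; toℕ)
import Data.Fin.Properties as Fin
open import Data.List.Base using (allFin) renaming (map to mapList)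
open import Data.List.Extrema.Nat using (max; xs≤max)
open import Data.List.Membership.Propositional.Properties using (∈-map⁺; ∈-allFin)
import Data.List.Relation.Unary.All as ListAll
open import Data.Maybe.Base using (Maybe; just; nothing; fromMaybe; _>>=_)
  renaming (map to mapMaybe)
open import Data.Maybe using (Is-just)
import Data.Maybe.Properties as Maybe
open import Data.Maybe.Relation.Unary.All as All using (All; just; nothing)
open import Data.Maybe.Relation.Unary.Any using (just)
open import Data.Nat.Base using (ℕ; zero; suc; _+_; _*_; _≤_; _<_; z≤n; s≤s)
open import Data.Nat.Properties
open import Data.Product.Base using (Σ; ∃-syntax; _×_; _,_; proj₁; proj₂)
import Data.Product.Properties as Product
open import Data.Sum.Base using (_⊎_; inj₁; inj₂; [_,_]′)
open import Data.Vec.Base using (Vec; []; _∷_; lookup; tabulate; replicate; _[_]≔_)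
  renaming (map to mapVec)
import Data.Vec.Properties as Vec
open import Function.Base using (id; _∘_; const)
open import Function.Bundles using (Bijection)
open import Level using (Level)
open import Relation.Binary.PropositionalEquality as ≡
  using (_≡_; _≢_; cong; subst)
import Relation.Binary.Reasoning.Setoid as SetoidReasoning
open import Relation.Binary.Structures using (IsDecTotalOrder)
open import Relation.Nullary.Decidable.Core using (Dec; yes; no; does)
open import Relation.Nullary.Negation.Core using (¬_; contradiction)

private
  variable
    A : Set
    σ ℓ k m n : ℕ

-- Partial words and memories

PartialWord : ℕ → Set
PartialWord σ = ℕ → Maybe (Fin σ)

infixl 6 _[_↦_]

_[_↦_] : PartialWord σ → ℕ → Fin σ → PartialWord σ
(K [ s ↦ x ]) i = if does (i ≟ s) then just x else K i

↦-cases : ∀ (K : PartialWord σ) s x i →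
  (i ≡ s × (K [ s ↦ x ]) i ≡ just x) ⊎ (K [ s ↦ x ]) i ≡ K i
↦-cases K zero    x zero    = inj₁ (≡.refl , ≡.refl)
↦-cases K zero    x (suc i) = inj₂ ≡.refl
↦-cases K (suc s) x zero    = inj₂ ≡.refl
↦-cases K (suc s) x (suc i) with ↦-cases (K ∘ suc) s x i
... | inj₁ (≡.refl , eq) = inj₁ (≡.refl , eq)
... | inj₂ eq            = inj₂ eq

↦-updates : ∀ (K : PartialWord σ) s x → (K [ s ↦ x ]) s ≡ just x
↦-updates K zero    x = ≡.refl
↦-updates K (suc s) x = ↦-updates (K ∘ suc) s x

↦-shift : ∀ (K : PartialWord σ) p s x u →
  (K [ p + s ↦ x ]) (p + u) ≡ ((λ v → K (p + v)) [ s ↦ x ]) u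
↦-shift K zero    s x u = ≡.refl
↦-shift K (suc p) s x u = ↦-shift (K ∘ suc) p s x u

↦-cong : ∀ {K L : PartialWord σ} s x → (∀ i → K i ≡ L i) →
  ∀ i → (K [ s ↦ x ]) i ≡ (L [ s ↦ x ]) i
↦-cong s x K≗L i = cong (if does (i ≟ s) then just x else_) (K≗L i)

-- Extends a memory by `nothing` to a partial word on all positions. Shifting then becomes a
-- translation of the argument, with no bound to carry.
recall : Vec (Maybe A) n → ℕ → Maybe A
recall H u = (H ‼ u) >>= id

recall-lookup : ∀ (H : Vec (Maybe A) n) i → recall H (toℕ i) ≡ lookup H i
recall-lookup (_ ∷ H) zero    = ≡.refl
recall-lookup (_ ∷ H) (suc i) = recall-lookup H i

recall-beyond : ∀ (H : Vec (Maybe A) n) {u} → n ≤ u → recall H u ≡ nothing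
recall-beyond []      _         = ≡.refl
recall-beyond (_ ∷ H) (s≤s n≤u) = recall-beyond H n≤u

recall-replicate : ∀ n u → recall (replicate {A = Maybe A} n nothing) u ≡ nothing
recall-replicate zero    u       = ≡.refl
recall-replicate (suc n) zero    = ≡.refl
recall-replicate (suc n) (suc u) = recall-replicate n u

recall-tabulate : ∀ n (f : ℕ → Maybe A) → (∀ {u} → n ≤ u → f u ≡ nothing) →
  ∀ u → recall (tabulate {n = n} (f ∘ toℕ)) u ≡ f u
recall-tabulate zero    f beyond u       = ≡.sym (beyond z≤n)
recall-tabulate (suc n) f beyond zero    = ≡.refl
recall-tabulate (suc n) f beyond (suc u) = recall-tabulate n (f ∘ suc) (beyond ∘ s≤s) u

recall-shifted : ∀ g (H : Memory σ n) u → recall (shifted g H) u ≡ recall H (u + g)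
recall-shifted g H = recall-tabulate _ (λ u → recall H (u + g))
  (λ n≤u → recall-beyond H (≤-trans n≤u (m≤m+n _ g)))

recall-update : ∀ (H : Vec (Maybe (Fin σ)) n) i x u →
  recall (H [ i ]≔ just x) u ≡ (recall H [ toℕ i ↦ x ]) u
recall-update (_ ∷ H) zero    x zero    = ≡.refl
recall-update (_ ∷ H) zero    x (suc u) = ≡.refl
recall-update (_ ∷ H) (suc i) x zero    = ≡.refl
recall-update (_ ∷ H) (suc i) x (suc u) = recall-update H i x u

‼-defined : ∀ (t : Vec A n) {s} → s < n → ∃[ x ] t ‼ s ≡ just x
‼-defined (x ∷ t) {zero}  _         = x , ≡.refl
‼-defined (x ∷ t) {suc s} (s≤s s<n) = ‼-defined t s<n

‼-bound : ∀ (t : Vec A n) s {x} → t ‼ s ≡ just x → s < n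
‼-bound (_ ∷ t) zero    _  = s≤s z≤n
‼-bound (_ ∷ t) (suc s) eq = s≤s (‼-bound t s eq)

-- Positions known to K but beyond the end of t are unconstrained.
Refines : PartialWord σ → Word σ n → Set
Refines K t = ∀ s {x} → t ‼ s ≡ just x → All (_≡ x) (K s)

refines-∷ : ∀ {K : PartialWord σ} {x} {t : Word σ n} →
  All (_≡ x) (K 0) → Refines (K ∘ suc) t → Refines K (x ∷ t)
refines-∷ c r zero    ≡.refl = c
refines-∷ c r (suc s) eq     = r s eq

refines-↦ : ∀ {K : PartialWord σ} {t : Word σ n} {s x} →
  t ‼ s ≡ just x → Refines K t → Refines (K [ s ↦ x ]) t
refines-↦ {K = K} {s = s} {x} ts r i ti with ↦-cases K s x i
... | inj₂ eq rewrite eq = r i ti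
... | inj₁ (≡.refl , eq) rewrite eq = just (Maybe.just-injective (≡.trans (≡.sym ts) ti))

refines-↦-letter : ∀ {K : PartialWord σ} {t : Word σ n} {s x y} →
  Refines (K [ s ↦ x ]) t → t ‼ s ≡ just y → x ≡ y
refines-↦-letter {K = K} {s = s} {x} r ts with r s ts
... | c rewrite ↦-updates K s x = All.drop-just c

-- Overwriting could forget a letter of `K` at `s`. Compatibility says that a letter known there is
-- already `x`, so nothing is lost.
refines-↦-inv : ∀ {K : PartialWord σ} {t : Word σ n} {s x} →
  All (_≡ x) (K s) → Refines (K [ s ↦ x ]) t → Refines K t
refines-↦-inv {K = K} {s = s} {x} c r i ti with ↦-cases K s x i | r i ti
... | inj₂ eq            | d rewrite eq = d
... | inj₁ (≡.refl , eq) | d rewrite eq | All.drop-just d = c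

refines-↦-‼ : ∀ {K : PartialWord σ} {t : Word σ n} {s x} →
  s < n → Refines (K [ s ↦ x ]) t → t ‼ s ≡ just x
refines-↦-‼ {K = K} {t} s<n r with y , eq ← ‼-defined t s<n =
  ≡.trans eq (cong just (≡.sym (refines-↦-letter {K = K} {t = t} r eq)))

fromMaybe-compatible : ∀ (a : A) d → All (_≡ fromMaybe a d) d
fromMaybe-compatible a nothing  = nothing
fromMaybe-compatible a (just x) = just ≡.refl

fill : Fin σ → PartialWord σ → ∀ n → Word σ n
fill a K zero    = []
fill a K (suc n) = fromMaybe a (K 0) ∷ fill a (K ∘ suc) n

-- Supplies a text of every length that refines `K`, so that facts holding for all refining texts
-- can be instantiated.
fill-refines : ∀ a (K : PartialWord σ) n → Refines K (fill a K n)
fill-refines a K (suc n) = refines-∷ (fromMaybe-compatible a (K 0)) (fill-refines a (K ∘ suc) n)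

-- Runs of the generic algorithm

if-yes : ∀ {p a} {P : Set p} {A : Set a} {x y : A} (P? : Dec P) → P → (if does P? then x else y) ≡ x
if-yes (yes _) _ = ≡.refl
if-yes (no ¬p) p = contradiction p ¬p

if-no : ∀ {p a} {P : Set p} {A : Set a} {x y : A} (P? : Dec P) → ¬ P → (if does P? then x else y) ≡ y
if-no (yes p) ¬p = contradiction p ¬p
if-no (no _)  _  = ≡.refl

if-just⁻ : ∀ {p} {P : Set p} {x y : A} (P? : Dec P) →
  _≡_ {A = Maybe A} (if does P? then just x else nothing) (just y) → x ≡ y × P
if-just⁻ (yes p) ≡.refl = ≡.refl , p

maximum : (Fin n → ℕ) → ℕ
maximum {n} f = max 0 (mapList f (allFin n))

≤-maximum : ∀ (f : Fin n → ℕ) i → f i ≤ maximum f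
≤-maximum {n} f i = ListAll.lookup (xs≤max 0 (mapList f (allFin n))) (∈-map⁺ f (∈-allFin i))

module _ {w : Word σ ℓ} {Q : Set} (Γ : MatchingMachine w Q) where

  admit-just : ∀ {c} → proj₂ c + ℓ ≤ n → admit Γ n c ≡ just c
  admit-just {c = _ , p} p+ℓ≤n = if-yes (p + ℓ ≤? _) p+ℓ≤n

  admit-just⁻ : ∀ {c c′} → admit Γ n c ≡ just c′ → c ≡ c′ × proj₂ c + ℓ ≤ n
  admit-just⁻ {c = _ , p} = if-just⁻ (p + ℓ ≤? _)

  iteration-suc : ∀ {t : Word σ n} {i q p x} → iteration Γ t i ≡ just (q , p) →
    t ‼ (p + α Γ q) ≡ just x → p + γ Γ q x + ℓ ≤ n →
    iteration Γ t (suc i) ≡ just (δ Γ q x , p + γ Γ q x)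
  iteration-suc it tx fits rewrite it | tx = admit-just fits

  iteration-suc⁻ : ∀ (t : Word σ n) i {c} → iteration Γ t (suc i) ≡ just c →
    ∃[ q ] ∃[ p ] ∃[ x ] iteration Γ t i ≡ just (q , p) × t ‼ (p + α Γ q) ≡ just x ×
      p + γ Γ q x + ℓ ≤ n × c ≡ (δ Γ q x , p + γ Γ q x)
  iteration-suc⁻ t i eq with iteration Γ t i
  ... | just (q , p) with t ‼ (p + α Γ q) in tx
  ...   | just x with ≡.refl , fits ← admit-just⁻ eq = q , p , x , ≡.refl , tx , fits , ≡.refl

  iteration-pred : ∀ (t : Word σ n) i → Is-just (iteration Γ t (suc i)) → Is-just (iteration Γ t i)
  iteration-pred t i ij with iteration Γ t i
  ... | just _ = just _

  iteration-pred-≤ : ∀ (t : Word σ n) {i j} → i ≤ j →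
    Is-just (iteration Γ t j) → Is-just (iteration Γ t i)
  iteration-pred-≤ t {j = zero}  z≤n ij = ij
  iteration-pred-≤ t {i} {suc j} i≤j ij with m≤n⇒m<n∨m≡n i≤j
  ... | inj₁ (s≤s i≤j′) = iteration-pred-≤ t i≤j′ (iteration-pred t j ij)
  ... | inj₂ ≡.refl     = ij

module _ {w : Word σ ℓ} (Γ : MatchingMachine w (Fin k)) where

  shiftBound : ℕ
  shiftBound = maximum λ q → maximum (γ Γ q)

  γ≤shiftBound : ∀ q x → γ Γ q x ≤ shiftBound
  γ≤shiftBound q x = ≤-trans (≤-maximum (γ Γ q) x) (≤-maximum (λ q → maximum (γ Γ q)) q)

  -- Each iteration shifts by at most `shiftBound`. The term `suc (order Γ)` leaves room for the
  -- access, which outside the pre-match states may lie beyond the window, and `ℓ` leaves room for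
  -- the window itself.
  enough : ℕ → ℕ
  enough m = m * shiftBound + (suc (order Γ) + ℓ)

  iteration-enough : ∀ m → enough m ≤ n → (t : Word σ n) →
    ∃[ q ] ∃[ p ] iteration Γ t m ≡ just (q , p) × p ≤ m * shiftBound
  iteration-enough zero N≤n t =
    initial Γ , 0 , admit-just Γ (≤-trans (m≤n+m ℓ (suc (order Γ))) N≤n) , z≤n
  iteration-enough {n = n} (suc m) N≤n t
    with q , p , it , p≤ ← iteration-enough m
           (≤-trans (+-monoˡ-≤ _ (m≤n+m (m * shiftBound) shiftBound)) N≤n) t
    with x , tx ← ‼-defined t {p + α Γ q} (≤-trans
           (subst (_≤ enough m) (+-suc p (α Γ q)) (+-mono-≤ p≤ (≤-trans (α<1+order Γ q) (m≤m+n _ ℓ))))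
           (≤-trans (+-monoˡ-≤ _ (m≤n+m (m * shiftBound) shiftBound)) N≤n))
    = δ Γ q x , p + γ Γ q x ,
      iteration-suc Γ {t = t} {i = m} it tx
        (≤-trans (+-mono-≤ p+γ≤ (m≤n+m ℓ (suc (order Γ)))) N≤n) , p+γ≤
    where
    p+γ≤ : p + γ Γ q x ≤ suc m * shiftBound
    p+γ≤ = subst (p + γ Γ q x ≤_) (+-comm _ shiftBound) (+-mono-≤ p≤ (γ≤shiftBound q x))

-- The expansion follows the original machine

  private
    Γ̂ = expansion Γ

  recall-slot : ∀ q (H : Memory σ (order Γ)) → recall H (α Γ q) ≡ lookup H (slot Γ q)
  recall-slot q H = ≡.trans (cong (recall H) (≡.sym (Fin.toℕ-fromℕ< (α<1+order Γ q))))
                            (recall-lookup H (slot Γ q))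

  expansionδ-compatible : ∀ q H {x} → All (_≡ x) (lookup H (slot Γ q)) →
    δ Γ̂ (just (q , H)) x ≡ next Γ q H x
  expansionδ-compatible q H {x} c with lookup H (slot Γ q)
  expansionδ-compatible q H {x} (just ≡.refl) | just _ = if-yes (x Fin.≟ x) ≡.refl
  expansionδ-compatible q H nothing           | nothing = ≡.refl

  expansionδ-incompatible : ∀ q H {a x} → lookup H (slot Γ q) ≡ just a → x ≢ a →
    δ Γ̂ (just (q , H)) x ≡ nothing
  expansionδ-incompatible q H {a} {x} eq x≢a with lookup H (slot Γ q)
  expansionδ-incompatible q H {a} {x} ≡.refl x≢a | just _ =
    if-no (a Fin.≟ x) (x≢a ∘ ≡.sym)

  expansionδ-project : ∀ q H x {q′ H′} →
    δ Γ̂ (just (q , H)) x ≡ just (q′ , H′) → δ Γ q x ≡ q′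
  expansionδ-project q H x eq with lookup H (slot Γ q)
  expansionδ-project q H x ≡.refl | nothing = ≡.refl
  expansionδ-project q H x eq | just a with if-just⁻ (a Fin.≟ x) eq
  ... | ≡.refl , _ = ≡.refl

  iteration-project : ∀ (t : Word σ n) i {q H p} →
    iteration Γ̂ t i ≡ just (just (q , H) , p) → iteration Γ t i ≡ just (q , p)
  iteration-project t zero eq
    with ≡.refl , fits ← admit-just⁻ Γ̂ eq = admit-just Γ fits
  iteration-project t (suc i) eq with iteration-suc⁻ Γ̂ t i eq
  -- The previous state cannot be `nothing`, since the sink of the expansion is absorbing.
  ... | just (q₀ , H₀) , p₀ , x , it , tx , fits , eq′
    with ≡.refl ← expansionδ-project q₀ H₀ x (≡.sym (cong proj₁ eq′))
       | ≡.refl ← cong proj₂ eq′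
    = iteration-suc Γ {t = t} {i} (iteration-project t i it) tx fits

  nextMemory : Fin k → Memory σ (order Γ) → Fin σ → Memory σ (order Γ)
  nextMemory q H x = shifted (γ Γ q x) (H [ slot Γ q ]≔ just x)

  -- K collects the letters read during the first i iterations on a text of
  -- length n; H is the part of K from position p on.
  record Tracks (n i : ℕ) (K : PartialWord σ)
                (q : Fin k) (H : Memory σ (order Γ)) (p : ℕ) : Set where
    field
      run      : ∀ (t : Word σ n) → Refines K t → iteration Γ t i ≡ just (q , p)
      expanded : ∀ (t : Word σ n) → Refines K t → iteration Γ̂ t i ≡ just (just (q , H) , p)
      memory   : ∀ u → recall H u ≡ K (p + u)
      read     : ∀ (t : Word σ n) → Refines K t → ∀ {s a} → K s ≡ just a →
                 ∃[ j ] j < i × accessed Γ t j ≡ just s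

    known : lookup H (slot Γ q) ≡ K (p + α Γ q)
    known = ≡.trans (≡.sym (recall-slot q H)) (memory (α Γ q))

  open Tracks

  tracks-initial : ℓ ≤ n → Tracks n 0 (const nothing) (initial Γ) (replicate _ nothing) 0
  tracks-initial ℓ≤n = record
    { run      = λ t _ → admit-just Γ ℓ≤n
    ; expanded = λ t _ → admit-just Γ̂ ℓ≤n
    ; memory   = recall-replicate (suc (order Γ))
    ; read     = λ t _ ()
    }

  -- Fixing the letter about to be read makes the next iteration the same on all refining texts.
  -- Compatibility with `K` keeps the expansion off its sink, and the two bounds put the access
  -- inside the text and the next window before its end.
  tracks-suc : ∀ {i K q H p x} → Tracks n i K q H p → All (_≡ x) (K (p + α Γ q)) →
    p + α Γ q < n → p + γ Γ q x + ℓ ≤ n →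
    Tracks n (suc i) (K [ p + α Γ q ↦ x ]) (δ Γ q x) (nextMemory q H x) (p + γ Γ q x)
  tracks-suc {n = n} {i} {K} {q} {H} {p} {x} tr c s<n fits = record
    { run      = λ t r → iteration-suc Γ {t = t} {i} (run tr t (weaken t r))
                           (refines-↦-‼ {K = K} {t} s<n r) fits
    ; expanded = λ t r → ≡.trans
        (iteration-suc Γ̂ {t = t} {i} (expanded tr t (weaken t r))
                           (refines-↦-‼ {K = K} {t} s<n r) fits)
        (cong (λ s → just (s , p + g))
          (expansionδ-compatible q H (subst (All (_≡ x)) (≡.sym (known tr)) c)))
    ; memory   = agree
    ; read     = read′
    }
    where
    g = γ Γ q x
    H⁺ = H [ slot Γ q ]≔ just x

    weaken : ∀ (t : Word σ n) → Refines (K [ p + α Γ q ↦ x ]) t → Refines K t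
    weaken t = refines-↦-inv {t = t} c

    agree : ∀ u → recall (nextMemory q H x) u ≡ (K [ p + α Γ q ↦ x ]) (p + g + u)
    agree u = begin
      recall (shifted g H⁺) u                       ≡⟨ recall-shifted g H⁺ u ⟩
      recall H⁺ (u + g)                             ≡⟨ recall-update H (slot Γ q) x (u + g) ⟩
      (recall H [ toℕ (slot Γ q) ↦ x ]) (u + g)     ≡⟨ cong (λ s → (recall H [ s ↦ x ]) (u + g))
                                                         (Fin.toℕ-fromℕ< (α<1+order Γ q)) ⟩
      (recall H [ α Γ q ↦ x ]) (u + g)              ≡⟨ ↦-cong (α Γ q) x (memory tr) (u + g) ⟩
      ((λ v → K (p + v)) [ α Γ q ↦ x ]) (u + g)     ≡⟨ ↦-shift K p (α Γ q) x (u + g) ⟨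
      (K [ p + α Γ q ↦ x ]) (p + (u + g))           ≡⟨ cong (K [ p + α Γ q ↦ x ])
                                                         (≡.trans (cong (p +_) (+-comm u g))
                                                                  (≡.sym (+-assoc p g u))) ⟩
      (K [ p + α Γ q ↦ x ]) (p + g + u)             ∎
      where open ≡.≡-Reasoning

    read′ : ∀ (t : Word σ n) → Refines (K [ p + α Γ q ↦ x ]) t →
      ∀ {s a} → (K [ p + α Γ q ↦ x ]) s ≡ just a → ∃[ j ] j < suc i × accessed Γ t j ≡ just s
    read′ t r {s} Ks with ↦-cases K (p + α Γ q) x s
    ... | inj₁ (≡.refl , _) =
      i , n<1+n i , cong (mapMaybe λ (q , p) → p + α Γ q) (run tr t (weaken t r))
    ... | inj₂ eq with j , j<i , ac ← read tr t (weaken t r) (≡.trans (≡.sym eq) Ks) =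
      j , m<n⇒m<1+n j<i , ac

  -- Only the letters read matter, so the same `K` governs longer texts too. The quantification over
  -- `n′` is what later allows a text to be lengthened.
  tracks : ∀ (t : Word σ n) i {q p} → iteration Γ t i ≡ just (q , p) →
    ∃[ K ] ∃[ H ] Refines K t × (∀ {n′} → n ≤ n′ → Tracks n′ i K q H p)
  tracks t zero eq with ≡.refl , fits ← admit-just⁻ Γ eq =
    const nothing , _ , (λ _ _ → nothing) , λ n≤n′ → tracks-initial (≤-trans fits n≤n′)
  tracks t (suc i) eq
    with q , p , x , it , tx , fits , ≡.refl ← iteration-suc⁻ Γ t i eq
    with K , H , r , tr ← tracks t i it
    = K [ p + α Γ q ↦ x ] , nextMemory q H x , refines-↦ {K = K} {t} tx r , λ n≤n′ →
      tracks-suc (tr n≤n′) (r _ tx) (≤-trans (‼-bound t _ tx) n≤n′) (≤-trans fits n≤n′)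

  state⁻ : ∀ {Q} (Δ : MatchingMachine w Q) (t : Word σ n) i {q} → state Δ t i ≡ just q →
    ∃[ p ] iteration Δ t i ≡ just (q , p)
  state⁻ Δ t i eq with iteration Δ t i
  state⁻ Δ t i ≡.refl | just (q , p) = p , ≡.refl

  state⁺ : ∀ {Q} (Δ : MatchingMachine w Q) (t : Word σ n) i {q p} →
    iteration Δ t i ≡ just (q , p) → state Δ t i ≡ just q
  state⁺ Δ t i = cong (mapMaybe proj₁)

  -- The letters remembered along a run come from one text and cannot contradict it, so the
  -- expansion follows the run without falling into its sink.
  expand-reachable : ∀ {q} → Reachable Γ q → ∃[ H ] Reachable Γ̂ (just (q , H))
  expand-reachable (n , t , i , st)
    with p , it ← state⁻ Γ t i st
    with K , H , r , tr ← tracks t i it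
    = H , n , t , i , state⁺ Γ̂ t i (expanded (tr ≤-refl) t r)

  reachable-tracks : ∀ {q H} → Reachable Γ̂ (just (q , H)) →
    ∃[ n ] Σ (Word σ n) λ t → ∃[ i ] ∃[ K ] ∃[ p ]
      Refines K t × (∀ {n′} → n ≤ n′ → Tracks n′ i K q H p)
  reachable-tracks (n , t , i , st)
    with p , it ← state⁻ Γ̂ t i st
    with K , H , r , tr ← tracks t i (iteration-project t i it)
    -- The projected run rebuilds a memory of its own. The expansion being deterministic, it is the
    -- given `H`.
    with ≡.refl ← ≡.trans (≡.sym it) (expanded (tr ≤-refl) t r)
    = n , t , i , K , p , r , tr

  -- The text reaching `(q , H)` may hold another letter at the next access, or be too short for one
  -- more iteration. It is replaced by a longer one that agrees with it on the letters read and has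
  -- `x` there.
  reachable-next : ∀ {q H x} → Reachable Γ̂ (just (q , H)) → All (_≡ x) (lookup H (slot Γ q)) →
    Reachable Γ̂ (just (δ Γ q x , nextMemory q H x))
  reachable-next {q} {H} {x} re c with n , t , i , K , p , r , tr ← reachable-tracks re =
    N , t′ , suc i , state⁺ Γ̂ t′ (suc i) (expanded tr′ t′ (fill-refines x K′ N))
    where
    -- One summand per demand: the length from which `tr` holds, the access, and the window after
    -- the shift.
    N = n + (suc (p + α Γ q) + (p + γ Γ q x + ℓ))
    K′ = K [ p + α Γ q ↦ x ]
    t′ = fill x K′ N
    tr′ = tracks-suc (tr (m≤m+n n _)) (subst (All (_≡ x)) (known (tr ≤-refl)) c)
            (≤-trans (m≤m+n _ _) (m≤n+m _ n)) (≤-trans (m≤n+m _ (suc (p + α Γ q))) (m≤n+m _ n))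

  -- A letter remembered at the slot was read by an earlier iteration at the very position that the
  -- current one accesses.
  nonredundant-memory : ¬ Redundant Γ →
    ∀ {q H} → Reachable Γ̂ (just (q , H)) → lookup H (slot Γ q) ≡ nothing
  nonredundant-memory nonred {q} {H} re with lookup H (slot Γ q) in eq
  ... | nothing = ≡.refl
  ... | just a
    with n , t , i , K , p , r , tr ← reachable-tracks re
    with j , j<i , ac ← read (tr ≤-refl) t r (≡.trans (≡.sym (known (tr ≤-refl))) eq)
    = ⊥-elim (nonred (n , t , j , i , _ , j<i , ac ,
        cong (mapMaybe λ (q , p) → p + α Γ q) (run (tr ≤-refl) t r)))

  -- Standard machines: one memory per state

  canonical : AllReachable Γ → Fin k → Σ (ExpandedState Γ) λ s → s ≡ sink Γ̂ ⊎ Reachable Γ̂ s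
  canonical reach q with q Fin.≟ sink Γ
  -- `AllReachable` says nothing about the sink, so it is paired with the sink of the expansion,
  -- even if some `(sink Γ , H)` were reachable.
  ... | yes _  = nothing , inj₁ ≡.refl
  ... | no q≢⊙ with H , re ← expand-reachable (reach q q≢⊙) = just (q , H) , inj₂ re

  canonical-just : ∀ reach {q q′ H} → proj₁ (canonical reach q) ≡ just (q′ , H) →
    q ≡ q′ × q ≢ sink Γ
  canonical-just reach {q} eq with q Fin.≟ sink Γ
  canonical-just reach ≡.refl | no q≢⊙ = ≡.refl , q≢⊙

  -- Provides `k` distinct states of the expansion, whatever memories were chosen.
  canonical-injective : ∀ reach {q q′} →
    proj₁ (canonical reach q) ≡ proj₁ (canonical reach q′) → q ≡ q′
  canonical-injective reach {q} {q′} eq with q Fin.≟ sink Γ | q′ Fin.≟ sink Γ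
  ... | yes ≡.refl | yes ≡.refl = ≡.refl
  canonical-injective reach ≡.refl | no _ | no _ = ≡.refl

  -- A reachable state outside the image of canonical would give k + 1 states
  -- of the expansion, hence an injection of Fin (k + 1) into Fin k.
  standard-unique : ∀ reach → Standard Γ → ∀ {q H} → Reachable Γ̂ (just (q , H)) →
    proj₁ (canonical reach q) ≡ just (q , H)
  standard-unique reach standard {q} {H} re
    with Maybe.≡-dec (Product.≡-dec Fin._≟_ (Vec.≡-dec (Maybe.≡-dec Fin._≟_)))
           (proj₁ (canonical reach q)) (just (q , H))
  ... | yes eq = eq
  ... | no neq = ⊥-elim (Fin.<⇒notInjective {f = from ∘ states} (n<1+n k) (λ {i} {j} → from∘states-injective {i} {j}))
    where
    open Bijection standard using (surjective)

    -- A right inverse of a surjection is injective, here up to equality of the underlying states.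
    from : Σ (ExpandedState Γ) (λ s → s ≡ sink Γ̂ ⊎ Reachable Γ̂ s) → Fin k
    from s = proj₁ (surjective s)

    from-injective : ∀ s s′ → from s ≡ from s′ → proj₁ s ≡ proj₁ s′
    from-injective s s′ eq =
      ≡.trans (≡.sym (proj₂ (surjective s) ≡.refl)) (proj₂ (surjective s′) eq)

    states : Fin (suc k) → Σ (ExpandedState Γ) λ s → s ≡ sink Γ̂ ⊎ Reachable Γ̂ s
    states zero    = just (q , H) , inj₂ re
    states (suc i) = canonical reach i

    new : ∀ i → proj₁ (canonical reach i) ≢ just (q , H)
    new i eq with ≡.refl , _ ← canonical-just reach {i} eq = neq eq

    states-injective : ∀ i j → proj₁ (states i) ≡ proj₁ (states j) → i ≡ j
    states-injective zero    zero    _  = ≡.refl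
    states-injective zero    (suc j) eq = contradiction (≡.sym eq) (new j)
    states-injective (suc i) zero    eq = contradiction eq (new i)
    states-injective (suc i) (suc j) eq = cong suc (canonical-injective reach {i} {j} eq)

    from∘states-injective : ∀ {i j} → from (states i) ≡ from (states j) → i ≡ j
    from∘states-injective {i} {j} eq =
      states-injective i j (from-injective (states i) (states j) eq)

  -- The value at the sink is `nothing`. The sink row of the model is then the image of `π` under a
  -- constant map, that is, the point mass at the sink.
  canonicalLetter : AllReachable Γ → Fin k → Maybe (Fin σ)
  canonicalLetter reach q =
    proj₁ (canonical reach q) >>= λ (q′ , H) → lookup H (slot Γ q′)

  standard-memory : ∀ reach → Standard Γ → ∀ {q H} → Reachable Γ̂ (just (q , H)) →
    lookup H (slot Γ q) ≡ canonicalLetter reach q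
  standard-memory reach standard {q} {H} re =
    ≡.sym (cong (_>>= λ (q′ , H) → lookup H (slot Γ q′)) (standard-unique reach standard re))

  -- Uniqueness would identify a reachable `(sink Γ , H)` with `canonical` of the sink, which is
  -- `nothing`.
  sink-unreachable : ∀ reach → Standard Γ → ∀ {q H} → Reachable Γ̂ (just (q , H)) → q ≢ sink Γ
  sink-unreachable reach standard re =
    proj₂ (canonical-just reach {_} (standard-unique reach standard re))

  δ-compatible-≢sink : ∀ reach → Standard Γ → ∀ {q x} → q ≢ sink Γ →
    All (_≡ x) (canonicalLetter reach q) → δ Γ q x ≢ sink Γ
  δ-compatible-≢sink reach standard {q} {x} q≢⊙ c with H , re ← expand-reachable (reach q q≢⊙) =
    sink-unreachable reach standard
      (reachable-next re (subst (All (_≡ x)) (≡.sym (standard-memory reach standard re)) c))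

  -- The expansion sends a letter contradicting the memory to its sink, and `SinkCompatible` carries
  -- this over to `Γ`.
  δ-incompatible-≡sink : ∀ reach → Standard Γ → SinkCompatible Γ → ∀ {q a x} → q ≢ sink Γ →
    canonicalLetter reach q ≡ just a → x ≢ a → δ Γ q x ≡ sink Γ
  δ-incompatible-≡sink reach standard compatible {q} q≢⊙ eq x≢a
    with H , re ← expand-reachable (reach q q≢⊙) =
    compatible q H _ re
      (expansionδ-incompatible q H (≡.trans (standard-memory reach standard re) eq) x≢a)

-- Expectations given a partial text

module _ {c ℓ₁ ℓ₂ : Level} (𝔽 : OrderedField c ℓ₁ ℓ₂) where

  private
    module F = OrderedField 𝔽

  open OrderedField 𝔽 using
    (Carrier; _≈_; _≤ᶠ_; 0#; 1#; _+ᶠ_; _*ᶠ_; _÷_; ∑; indicator; setoid; semiring)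
  open Models 𝔽
  open SemiringSum semiring using
    (sum-cong-≋; sum-replicate-zero; ∑-comm; *-distribˡ-sum; *-distribʳ-sum)
  open SetoidReasoning setoid

  private
    module ≤ᶠ = IsDecTotalOrder F.isDecTotalOrder

  -- If `1# ≤ᶠ 0#`, then `- 1#` is nonnegative, and `1#` is its square.
  0≤1 : 0# ≤ᶠ 1#
  0≤1 with ≤ᶠ.total 0# 1#
  ... | inj₁ 0≤1 = 0≤1
  ... | inj₂ 1≤0 = ≤ᶠ.≤-respʳ-≈ square (F.*-nonneg 0≤-1 0≤-1)
    where
    open RingProperties F.ring using (-1*x≈-x; -‿involutive)
    square : F.- 1# *ᶠ F.- 1# ≈ 1#
    square = F.trans (-1*x≈-x (F.- 1#)) (-‿involutive 1#)
    0≤-1 : 0# ≤ᶠ F.- 1#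
    0≤-1 = ≤ᶠ.≤-respˡ-≈ (F.-‿inverseʳ 1#)
             (≤ᶠ.≤-respʳ-≈ (F.+-identityˡ _) (F.+-monoˡ-≤ (F.- 1#) 1≤0))

  +-nonneg : ∀ {x y} → 0# ≤ᶠ x → 0# ≤ᶠ y → 0# ≤ᶠ x +ᶠ y
  +-nonneg {x} {y} 0≤x 0≤y =
    ≤ᶠ.trans 0≤y (≤ᶠ.≤-respˡ-≈ (F.+-identityˡ y) (F.+-monoˡ-≤ y 0≤x))

  ∑-nonneg : ∀ {n} (f : Fin n → Carrier) → (∀ i → 0# ≤ᶠ f i) → 0# ≤ᶠ ∑ f
  ∑-nonneg {zero}  f f≥0 = ≤ᶠ.refl
  ∑-nonneg {suc n} f f≥0 = +-nonneg (f≥0 zero) (∑-nonneg (f ∘ suc) (f≥0 ∘ suc))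

  ∑-zero : ∀ {n} (f : Fin n → Carrier) → (∀ i → f i ≈ 0#) → ∑ f ≈ 0#
  ∑-zero {n} f f≈0 = F.trans (sum-cong-≋ f≈0) (sum-replicate-zero n)

  ∑-single : ∀ {n} (f : Fin n → Carrier) a → (∀ i → i ≢ a → f i ≈ 0#) → ∑ f ≈ f a
  ∑-single f zero f≈0 =
    F.trans (F.+-congˡ (∑-zero (f ∘ suc) (λ i → f≈0 (suc i) λ ()))) (F.+-identityʳ _)
  ∑-single f (suc a) f≈0 =
    F.trans (F.+-cong (f≈0 zero λ ())
              (∑-single (f ∘ suc) a (λ i i≢a → f≈0 (suc i) (i≢a ∘ Fin.suc-injective))))
            (F.+-identityˡ _)

  ∑-*-congˡ : ∀ {n} (a : Fin n → Carrier) {f g : Fin n → Carrier} → (∀ i → f i ≈ g i) →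
    ∑ (λ i → a i *ᶠ f i) ≈ ∑ (λ i → a i *ᶠ g i)
  ∑-*-congˡ a f≈g = sum-cong-≋ (λ i → F.*-congˡ (f≈g i))

  ∑-*-comm : ∀ {m n} (a : Fin m → Carrier) (b : Fin n → Carrier) (e : Fin m → Fin n → Carrier) →
    ∑ (λ i → a i *ᶠ ∑ (λ j → b j *ᶠ e i j)) ≈ ∑ (λ j → b j *ᶠ ∑ (λ i → a i *ᶠ e i j))
  ∑-*-comm a b e = begin
    ∑ (λ i → a i *ᶠ ∑ (λ j → b j *ᶠ e i j))
      ≈⟨ sum-cong-≋ (λ i → *-distribˡ-sum (a i) (λ j → b j *ᶠ e i j)) ⟩
    ∑ (λ i → ∑ (λ j → a i *ᶠ (b j *ᶠ e i j)))
      ≈⟨ ∑-comm (λ i j → a i *ᶠ (b j *ᶠ e i j)) ⟩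
    ∑ (λ j → ∑ (λ i → a i *ᶠ (b j *ᶠ e i j)))
      ≈⟨ sum-cong-≋ (λ j → sum-cong-≋ (λ i → swap (a i) (b j) (e i j))) ⟩
    ∑ (λ j → ∑ (λ i → b j *ᶠ (a i *ᶠ e i j)))
      ≈⟨ sum-cong-≋ (λ j → *-distribˡ-sum (b j) (λ i → a i *ᶠ e i j)) ⟨
    ∑ (λ j → b j *ᶠ ∑ (λ i → a i *ᶠ e i j)) ∎
    where
    swap : ∀ x y z → x *ᶠ (y *ᶠ z) ≈ y *ᶠ (x *ᶠ z)
    swap x y z = F.trans (F.sym (F.*-assoc x y z))
                   (F.trans (F.*-congʳ (F.*-comm x y)) (F.*-assoc y x z))

  indicator-yes : ∀ {p} {P : Set p} (P? : Dec P) {x} → P → indicator P? x ≈ x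
  indicator-yes P? p = F.reflexive (if-yes P? p)

  indicator-no : ∀ {p} {P : Set p} (P? : Dec P) {x} → ¬ P → indicator P? x ≈ 0#
  indicator-no P? ¬p = F.reflexive (if-no P? ¬p)

  indicator-cong : ∀ {p} {P : Set p} (P? : Dec P) {x y} → x ≈ y → indicator P? x ≈ indicator P? y
  indicator-cong (yes _) x≈y = x≈y
  indicator-cong (no _)  x≈y = F.refl

  indicator-nonneg : ∀ {p} {P : Set p} (P? : Dec P) {x} → 0# ≤ᶠ x → 0# ≤ᶠ indicator P? x
  indicator-nonneg (yes _) 0≤x = 0≤x
  indicator-nonneg (no _)  0≤x = ≤ᶠ.refl

  *-indicator : ∀ {p} {P : Set p} (P? : Dec P) x y → x *ᶠ indicator P? y ≈ indicator P? x *ᶠ y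
  *-indicator (yes _) x y = F.refl
  *-indicator (no _)  x y = F.trans (F.zeroʳ x) (F.sym (F.zeroˡ y))

  ∑-indicator : ∀ {n} (a : Fin n) x → ∑ (λ i → indicator (a Fin.≟ i) x) ≈ x
  ∑-indicator a x =
    F.trans (∑-single (λ i → indicator (a Fin.≟ i) x) a
              (λ i i≢a → indicator-no (a Fin.≟ i) (i≢a ∘ ≡.sym)))
            (indicator-yes (a Fin.≟ a) ≡.refl)

  indicator-zero : ∀ {p} {P : Set p} (P? : Dec P) → indicator P? 0# ≈ 0#
  indicator-zero (yes _) = F.refl
  indicator-zero (no _)  = F.refl

  ÷-unique : ∀ {x y z} → ¬ (z ≈ 0#) → x *ᶠ z ≈ y → x ≈ y ÷ z
  ÷-unique {x} {y} {z} z≉0 xz≈y = begin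
    x                  ≈⟨ F.*-identityʳ x ⟨
    x *ᶠ 1#            ≈⟨ F.*-congˡ (F.*-inverseʳ z z≉0) ⟨
    x *ᶠ (z *ᶠ z F.⁻¹) ≈⟨ F.*-assoc x z _ ⟨
    x *ᶠ z *ᶠ z F.⁻¹   ≈⟨ F.*-congʳ xz≈y ⟩
    y ÷ z              ∎

  point : Fin n → Distribution n
  point a = record
    { mass   = λ i → indicator (i Fin.≟ a) 1#
    ; nonneg = λ i → indicator-nonneg (i Fin.≟ a) 0≤1
    ; total  = F.trans (∑-single (λ i → indicator (i Fin.≟ a) 1#) a
                         (λ i → indicator-no (i Fin.≟ a)))
                       (indicator-yes (a Fin.≟ a) ≡.refl)
    }

  pushforward : (Fin m → Fin n) → Distribution m → Distribution n
  pushforward f μ = record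
    { mass   = λ j → ∑ λ i → indicator (f i Fin.≟ j) (mass μ i)
    ; nonneg = λ j → ∑-nonneg (λ i → indicator (f i Fin.≟ j) (mass μ i))
                 (λ i → indicator-nonneg (f i Fin.≟ j) (nonneg μ i))
    ; total  = F.trans (∑-comm (λ j i → indicator (f i Fin.≟ j) (mass μ i)))
                 (F.trans (sum-cong-≋ (λ i → ∑-indicator (f i) (mass μ i))) (total μ))
    }

  -- An empty sum cannot be `1#`. The letter obtained serves to fill unread positions.
  inhabited : Distribution n → Fin n
  inhabited {zero}  μ = ⊥-elim (F.0≉1 (total μ))
  inhabited {suc n} μ = zero

  letterLaw : Distribution σ → Maybe (Fin σ) → Distribution σ
  letterLaw π nothing  = π
  letterLaw π (just a) = point a

  -- When the letter is known, all others have mass zero, so only compatible letters have to be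
  -- compared.
  ∑-letterLaw-cong : ∀ (π : Distribution σ) d {f g : Fin σ → Carrier} →
    (∀ x → All (_≡ x) d → f x ≈ g x) →
    ∑ (λ x → mass (letterLaw π d) x *ᶠ f x) ≈ ∑ (λ x → mass (letterLaw π d) x *ᶠ g x)
  ∑-letterLaw-cong π d {f} {g} f≈g = sum-cong-≋ (λ x → [ F.*-congˡ ∘ f≈g x , vanish x ]′ (support d x))
    where
    support : ∀ d x → All (_≡ x) d ⊎ mass (letterLaw π d) x ≈ 0#
    support nothing  x = inj₁ nothing
    support (just a) x with x Fin.≟ a
    ... | yes x≡a = inj₁ (just (≡.sym x≡a))
    ... | no x≢a  = inj₂ F.refl

    vanish : ∀ x → mass (letterLaw π d) x ≈ 0# →
      mass (letterLaw π d) x *ᶠ f x ≈ mass (letterLaw π d) x *ᶠ g x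
    vanish x μ≈0 = F.trans (F.trans (F.*-congʳ μ≈0) (F.zeroˡ _))
                           (F.sym (F.trans (F.*-congʳ μ≈0) (F.zeroˡ _)))

  ∑-mass-* : ∀ (μ : Distribution n) x → ∑ (λ i → mass μ i *ᶠ x) ≈ x
  ∑-mass-* μ x = F.trans (F.sym (*-distribʳ-sum x (mass μ)))
                   (F.trans (F.*-congʳ (total μ)) (F.*-identityˡ x))

  ∑-point-* : ∀ (a : Fin n) (f : Fin n → Carrier) → ∑ (λ i → mass (point a) i *ᶠ f i) ≈ f a
  ∑-point-* a f =
    F.trans (∑-single (λ i → mass (point a) i *ᶠ f i) a
              (λ i i≢a → F.trans (F.*-congʳ (indicator-no (i Fin.≟ a) i≢a)) (F.zeroˡ _)))
            (F.trans (F.*-congʳ (indicator-yes (a Fin.≟ a) ≡.refl)) (F.*-identityˡ _))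

  ∑words-cong : ∀ n {f g : Word σ n → Carrier} → (∀ t → f t ≈ g t) → ∑words n f ≈ ∑words n g
  ∑words-cong zero    f≈g = f≈g []
  ∑words-cong (suc n) f≈g = sum-cong-≋ (λ x → ∑words-cong n (λ t → f≈g (x ∷ t)))

  *-distribˡ-∑words : ∀ n x (f : Word σ n → Carrier) →
    x *ᶠ ∑words n f ≈ ∑words n (λ t → x *ᶠ f t)
  *-distribˡ-∑words zero    x f = F.refl
  *-distribˡ-∑words (suc n) x f =
    F.trans (*-distribˡ-sum x (λ y → ∑words n (λ t → f (y ∷ t))))
            (sum-cong-≋ (λ y → *-distribˡ-∑words n x (λ t → f (y ∷ t))))

  module _ (π : Distribution σ) where

    -- The conditional expectation of `f` given the letters in `K`. Defining it by recursion instead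
    -- of as a quotient gives it a meaning even when those letters have probability zero.
    expectation : ∀ n → PartialWord σ → (Word σ n → Carrier) → Carrier
    expectation zero    K f = f []
    expectation (suc n) K f =
      ∑ λ x → mass (letterLaw π (K 0)) x *ᶠ expectation n (K ∘ suc) (λ t → f (x ∷ t))

    expectation-cong : ∀ n K {f g : Word σ n → Carrier} →
      (∀ t → Refines K t → f t ≈ g t) → expectation n K f ≈ expectation n K g
    expectation-cong zero    K f≈g = f≈g [] (λ _ ())
    expectation-cong (suc n) K f≈g = ∑-letterLaw-cong π (K 0) λ x c →
      expectation-cong n (K ∘ suc) (λ t r → f≈g (x ∷ t) (refines-∷ c r))

    expectation-const : ∀ n K x → expectation n K (const x) ≈ x
    expectation-const zero    K x = F.refl
    expectation-const (suc n) K x =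
      F.trans (∑-*-congˡ (mass (letterLaw π (K 0))) (λ y → expectation-const n (K ∘ suc) x))
              (∑-mass-* (letterLaw π (K 0)) x)

    -- The law of total expectation over the letter at `s`. If that letter is known, the sum has a
    -- single term; otherwise independence lets the sum over it be moved in front of those over
    -- earlier positions.
    expectation-split : ∀ n K (f : Word σ n → Carrier) {s} → s < n →
      expectation n K f ≈ ∑ λ x → mass (letterLaw π (K s)) x *ᶠ expectation n (K [ s ↦ x ]) f
    expectation-split (suc n) K f {zero} _ =
      ∑-*-congˡ (mass (letterLaw π (K 0))) (λ x →
        F.sym (∑-point-* x (λ y → expectation n (K ∘ suc) (λ t → f (y ∷ t)))))
    expectation-split (suc n) K f {suc s} (s≤s s<n) =
      F.trans (∑-*-congˡ (mass (letterLaw π (K 0)))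
                (λ y → expectation-split n (K ∘ suc) (λ t → f (y ∷ t)) s<n))
              (∑-*-comm (mass (letterLaw π (K 0))) (mass (letterLaw π (K (suc s))))
                (λ y x → expectation n ((K ∘ suc) [ s ↦ x ]) (λ t → f (y ∷ t))))

    expectation-words : ∀ n (f : Word σ n → Carrier) →
      ∑words n (λ t → textProbability π t *ᶠ f t) ≈ expectation n (const nothing) f
    expectation-words zero    f = F.*-identityˡ (f [])
    expectation-words (suc n) f = sum-cong-≋ λ x → begin
      ∑words n (λ t → (mass π x *ᶠ textProbability π t) *ᶠ f (x ∷ t))
        ≈⟨ ∑words-cong n (λ t → F.*-assoc _ _ _) ⟩
      ∑words n (λ t → mass π x *ᶠ (textProbability π t *ᶠ f (x ∷ t)))
        ≈⟨ *-distribˡ-∑words n (mass π x) _ ⟨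
      mass π x *ᶠ ∑words n (λ t → textProbability π t *ᶠ f (x ∷ t))
        ≈⟨ F.*-congˡ (expectation-words n (λ t → f (x ∷ t))) ⟩
      mass π x *ᶠ expectation n (const nothing) (λ t → f (x ∷ t)) ∎

    probability-expectation : ∀ {p} n {P : Word σ n → Set p} (P? : ∀ t → Dec (P t)) →
      probability π n P? ≈ expectation n (const nothing) (λ t → indicator (P? t) 1#)
    probability-expectation n P? =
      F.trans (∑words-cong n (λ t → F.sym (F.trans (*-indicator (P? t) _ 1#) (F.*-identityʳ _))))
              (expectation-words n (λ t → indicator (P? t) 1#))

-- The sequence of states

  module _ {w : Word σ ℓ} (Γ : MatchingMachine w (Fin k)) where

    agrees? : ∀ (s s′ : Maybe (Fin k)) → Dec (s ≡ s′)
    agrees? = Maybe.≡-dec Fin._≟_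

    -- The indicator of the event of parsing `us` from iteration `i` on, peeled one state at a time
    -- to match the recursion of `pathWeight`.
    parsesFrom : ∀ {m} → Word σ n → ℕ → Vec (Fin k) m → Carrier
    parsesFrom t i []      = 1#
    parsesFrom t i (u ∷ us) =
      indicator (agrees? (state Γ t i) (just u)) (parsesFrom t (suc i) us)

    parsesFrom-tabulate : ∀ {m} (t : Word σ n) i (us : Vec (Fin k) m) (f : Fin m → Maybe (Fin k)) →
      (∀ j → f j ≡ state Γ t (i + toℕ j)) →
      indicator (Vec.≡-dec agrees? (tabulate f) (mapVec just us)) 1# ≈ parsesFrom t i us
    parsesFrom-tabulate t i []       f f≡ = F.refl
    parsesFrom-tabulate t i (u ∷ us) f f≡
      -- Both sides now test the same `f zero`, so one case distinction settles them together.
      rewrite ≡.sym (≡.trans (f≡ zero) (cong (state Γ t) (+-identityʳ i)))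
      with does (agrees? (f zero) (just u))
    ... | false = F.refl
    ... | true  = parsesFrom-tabulate t (suc i) us (f ∘ suc)
                    (λ j → ≡.trans (f≡ (suc j)) (cong (state Γ t) (+-suc i (toℕ j))))

    parsesFrom-parsed : ∀ {m} (t : Word σ n) (us : Vec (Fin k) (suc m)) →
      indicator (parsesFirst? Γ us t) 1# ≈ parsesFrom t 0 us
    parsesFrom-parsed t us = parsesFrom-tabulate t 0 us _ (λ j → ≡.refl)

    longEnough-≤ : ∀ {i j} → i ≤ j → LongEnough Γ j n → LongEnough Γ i n
    longEnough-≤ i≤j long t = iteration-pred-≤ Γ t i≤j (long t)

    longEnough-enough : ∀ m n → enough Γ m ≤ n → LongEnough Γ m n
    longEnough-enough m n N≤n t with q , p , it , _ ← iteration-enough Γ m N≤n t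
      rewrite it = just _

    is-just⁻ : ∀ {c : Maybe A} → Is-just c → ∃[ x ] c ≡ just x
    is-just⁻ (just {x} _) = x , ≡.refl

    -- `LongEnough` covers all texts, in particular one that refines `K` and has `x` at the next
    -- access. That its next iteration exists gives both bounds.
    room : Distribution σ → ∀ {i K q H p x} → Tracks Γ n i K q H p → LongEnough Γ (suc i) n →
      All (_≡ x) (K (p + α Γ q)) → p + α Γ q < n × p + γ Γ q x + ℓ ≤ n
    room {n = n} π {i} {K} {q} {H} {p} {x} tr long c
      with t ← fill x (K [ p + α Γ q ↦ x ]) n in t≡
      with r ← subst (Refines (K [ p + α Γ q ↦ x ])) t≡ (fill-refines x (K [ p + α Γ q ↦ x ]) n)
      with _ , it⁺ ← is-just⁻ (long t)
      with q₁ , p₁ , y , it , ty , fits , _ ← iteration-suc⁻ Γ t i it⁺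
      with ≡.refl ← ≡.trans (≡.sym it) (Tracks.run tr t (refines-↦-inv {t = t} c r))
      with ≡.refl ← refines-↦-letter {K = K} {t} r ty
      = ‼-bound t _ ty , fits

    -- The Markov model when the letter remembered at the slot is a function of the state

    module _ (π : Distribution σ) (letter : Fin k → Maybe (Fin σ))
             (letter-spec : ∀ {q H} → Reachable (expansion Γ) (just (q , H)) →
                lookup H (slot Γ q) ≡ letter q)
             where

      model : MarkovModel k
      model = record
        { π-M         = point (initial Γ)
        ; transitions = λ q → pushforward (δ Γ q) (letterLaw π (letter q))
        }

      -- A tracked state is reachable in the expansion, by any text that refines `K`, so
      -- `letter-spec` applies to it.
      tracks-letter : ∀ {i K q H p} → Tracks Γ n i K q H p → K (p + α Γ q) ≡ letter q
      tracks-letter {n = n} {i} {K} tr = ≡.trans (≡.sym (Tracks.known tr))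
        (letter-spec (n , t , i , state⁺ Γ (expansion Γ) t i
          (Tracks.expanded tr t (fill-refines (inhabited π) K n))))
        where t = fill (inhabited π) K n

      -- The Markov property: whatever letters `K` have been read, the future has a weight that
      -- depends on `q` alone. The induction is on the states still to come, with `K` arbitrary.
      expectation-parsesFrom : ∀ {m i K q H p} → Tracks Γ n i K q H p → LongEnough Γ (i + m) n →
        (us : Vec (Fin k) m) →
        expectation π n K (λ t → parsesFrom t (suc i) us) ≈ pathWeight model q us
      expectation-parsesFrom {n = n} {K = K} tr long [] = expectation-const π n K 1#
      expectation-parsesFrom {n = n} {suc m} {i} {K} {q} {H} {p} tr long (r ∷ rs) = begin
        expectation π n K f
          ≈⟨ expectation-split π n K f
               -- Any letter compatible with `K s` yields the bound: the known one, or an arbitrary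
               -- one if the position is unread.
               (proj₁ (room π tr long₁ (fromMaybe-compatible (inhabited π) (K s)))) ⟩
        ∑ (λ x → mass (letterLaw π (K s)) x *ᶠ expectation π n (K [ s ↦ x ]) f)
          ≈⟨ ∑-letterLaw-cong π (K s) (λ x c → after c) ⟩
        ∑ (λ x → mass (letterLaw π (K s)) x *ᶠ indicator (δ Γ q x Fin.≟ r) W)
          -- Here the past disappears: the law of the next letter, so far given by `K`, becomes a
          -- function of `q`.
          ≡⟨ cong (λ d → ∑ (λ x → mass (letterLaw π d) x *ᶠ indicator (δ Γ q x Fin.≟ r) W))
                  (tracks-letter tr) ⟩
        ∑ (λ x → mass (letterLaw π (letter q)) x *ᶠ indicator (δ Γ q x Fin.≟ r) W)
          ≈⟨ sum-cong-≋ (λ x → *-indicator (δ Γ q x Fin.≟ r) (mass (letterLaw π (letter q)) x) W) ⟩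
        ∑ (λ x → indicator (δ Γ q x Fin.≟ r) (mass (letterLaw π (letter q)) x) *ᶠ W)
          ≈⟨ *-distribʳ-sum W (λ x → indicator (δ Γ q x Fin.≟ r) (mass (letterLaw π (letter q)) x)) ⟨
        pathWeight model q (r ∷ rs) ∎
        where
        s = p + α Γ q
        W = pathWeight model r rs

        f : Word σ n → Carrier
        f t = parsesFrom t (suc i) (r ∷ rs)

        long⁺ : LongEnough Γ (suc i + m) n
        long⁺ = subst (λ j → LongEnough Γ j n) (+-suc i m) long

        long₁ : LongEnough Γ (suc i) n
        long₁ = longEnough-≤ (m≤m+n (suc i) m) long⁺

        after : ∀ {x} → All (_≡ x) (K s) →
          expectation π n (K [ s ↦ x ]) f ≈ indicator (δ Γ q x Fin.≟ r) W
        -- Once `x` is fixed, the next state is `δ Γ q x` on every refining text. The test against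
        -- `r` is thus constant, and the induction hypothesis handles the rest.
        after {x} c = F.trans (expectation-cong π n (K [ s ↦ x ]) reads) (branch (δ Γ q x Fin.≟ r))
          where
          tr⁺ = let s<n , fits = room π tr long₁ c in tracks-suc Γ tr c s<n fits

          reads : ∀ t → Refines (K [ s ↦ x ]) t →
            f t ≈ indicator (agrees? (just (δ Γ q x)) (just r)) (parsesFrom t (2 + i) rs)
          reads t re = F.reflexive
            (cong (λ z → indicator (agrees? z (just r)) (parsesFrom t (2 + i) rs))
                  (state⁺ Γ Γ t (suc i) (Tracks.run tr⁺ t re)))

          branch : (δ≟r : Dec (δ Γ q x ≡ r)) →
            expectation π n (K [ s ↦ x ])
              (λ t → indicator (agrees? (just (δ Γ q x)) (just r)) (parsesFrom t (2 + i) rs))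
            ≈ indicator δ≟r W
          branch (yes ≡.refl) =
            F.trans (expectation-cong π n _ (λ t _ →
                       indicator-yes (agrees? (just (δ Γ q x)) (just r)) ≡.refl))
                    (expectation-parsesFrom tr⁺ long⁺ rs)
          branch (no δ≢r) =
            F.trans (expectation-cong π n _ (λ t _ →
                       indicator-no (agrees? (just (δ Γ q x)) (just r)) (δ≢r ∘ Maybe.just-injective)))
                    (expectation-const π n _ 0#)

      statesFollow : StatesFollow Γ π model
      statesFollow m = (enough Γ m , longEnough-enough m) , law
        where
        law : ∀ n → LongEnough Γ m n → (us : Vec (Fin k) (suc m)) →
          probability π n (parsesFirst? Γ us) ≈ sequenceProbability model us
        law n long (u ∷ us) = begin
          probability π n (parsesFirst? Γ (u ∷ us))
            ≈⟨ probability-expectation π n (parsesFirst? Γ (u ∷ us)) ⟩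
          expectation π n (const nothing) (λ t → indicator (parsesFirst? Γ (u ∷ us) t) 1#)
            ≈⟨ expectation-cong π n (const nothing) starts ⟩
          expectation π n (const nothing)
            (λ t → indicator (u Fin.≟ initial Γ) (parsesFrom t 1 us))
            ≈⟨ branch (u Fin.≟ initial Γ) ⟩
          indicator (u Fin.≟ initial Γ) (pathWeight model u us)
            ≈⟨ F.*-identityˡ _ ⟨
          1# *ᶠ indicator (u Fin.≟ initial Γ) (pathWeight model u us)
            ≈⟨ *-indicator (u Fin.≟ initial Γ) 1# _ ⟩
          sequenceProbability model (u ∷ us) ∎
          where
          ℓ≤n : ℓ ≤ n
          -- Iteration 0 exists on any text, so the window fits at position 0.
          ℓ≤n = proj₂ (admit-just⁻ Γ
            (proj₂ (is-just⁻ (longEnough-≤ {j = m} z≤n long (fill (inhabited π) (const nothing) n)))))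

          tr : Tracks Γ n 0 (const nothing) (initial Γ) (replicate _ nothing) 0
          tr = tracks-initial Γ ℓ≤n

          starts : ∀ t → Refines (const nothing) t →
            indicator (parsesFirst? Γ (u ∷ us) t) 1# ≈
            indicator (u Fin.≟ initial Γ) (parsesFrom t 1 us)
          starts t r = F.trans (parsesFrom-parsed t (u ∷ us))
            (F.trans (F.reflexive (cong (λ z → indicator (agrees? z (just u)) (parsesFrom t 1 us))
                                        (state⁺ Γ Γ t 0 (Tracks.run tr t r))))
                     (flip (u Fin.≟ initial Γ)))
            where
            flip : (u≟o : Dec (u ≡ initial Γ)) →
              indicator (agrees? (just (initial Γ)) (just u)) (parsesFrom t 1 us) ≈
              indicator u≟o (parsesFrom t 1 us)
            flip (yes ≡.refl) = indicator-yes (agrees? (just (initial Γ)) (just u)) ≡.refl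
            flip (no u≢o)     = indicator-no (agrees? (just (initial Γ)) (just u))
                                  (u≢o ∘ ≡.sym ∘ Maybe.just-injective)

          branch : (u≟o : Dec (u ≡ initial Γ)) →
            expectation π n (const nothing) (λ t → indicator u≟o (parsesFrom t 1 us)) ≈
            indicator u≟o (pathWeight model u us)
          branch (yes ≡.refl) = expectation-parsesFrom tr long us
          branch (no _)       = expectation-const π n (const nothing) 0#

    -- Transition probabilities of a standard machine

    module _ (π : Distribution σ) (reach : AllReachable Γ)
             (standard : Standard Γ) (compatible : SinkCompatible Γ) where

      offSink : Fin k → Fin σ → Carrier
      offSink q x = if does (δ Γ q x Fin.≟ sink Γ) then 0# else mass π x

      ≢sink : ∀ {q} → ¬ (weightOffSink Γ π q ≈ 0#) → q ≢ sink Γ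
      ≢sink w≉0 ≡.refl = w≉0 (∑-zero (offSink (sink Γ))
        (λ x → F.reflexive (if-yes (δ Γ (sink Γ) x Fin.≟ sink Γ) (δ-sink Γ x))))

      -- The quotient formula in product form. With no letter remembered, no transition leads to the
      -- sink and the denominator is the total mass. With `a` remembered, every other letter leads
      -- to the sink, so both sums reduce to their term at `a`; `q′` being off the sink, the other
      -- letters add nothing to the numerator.
      transition-weight : ∀ q q′ → q ≢ sink Γ → q′ ≢ sink Γ → ∀ d → canonicalLetter Γ reach q ≡ d →
        mass (pushforward (δ Γ q) (letterLaw π d)) q′ *ᶠ weightOffSink Γ π q ≈ weightTo Γ π q q′
      transition-weight q q′ q≢⊙ q′≢⊙ nothing eq =
        F.trans (F.*-congˡ (F.trans (sum-cong-≋ (λ x → F.reflexive (if-no (δ Γ q x Fin.≟ sink Γ) (leaves x))))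
                                    (total π)))
                (F.*-identityʳ _)
        where
        leaves : ∀ x → δ Γ q x ≢ sink Γ
        leaves x = δ-compatible-≢sink Γ reach standard q≢⊙ (subst (All (_≡ x)) (≡.sym eq) nothing)
      transition-weight q q′ q≢⊙ q′≢⊙ (just a) eq = begin
        mass (pushforward (δ Γ q) (point a)) q′ *ᶠ weightOffSink Γ π q
          ≈⟨ F.*-cong (F.trans (∑-single (λ x → indicator (δ Γ q x Fin.≟ q′) (mass (point a) x)) a off)
                        (indicator-cong (δ Γ q a Fin.≟ q′) (indicator-yes (a Fin.≟ a) ≡.refl)))
                      (F.trans (∑-single (offSink q) a
                                 (λ x x≢a → F.reflexive (if-yes (δ Γ q x Fin.≟ sink Γ) (falls x≢a))))
                        (F.reflexive (if-no (δ Γ q a Fin.≟ sink Γ) leaves))) ⟩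
        indicator (δ Γ q a Fin.≟ q′) 1# *ᶠ mass π a
          ≈⟨ *-indicator (δ Γ q a Fin.≟ q′) 1# (mass π a) ⟨
        1# *ᶠ indicator (δ Γ q a Fin.≟ q′) (mass π a)
          ≈⟨ F.*-identityˡ _ ⟩
        indicator (δ Γ q a Fin.≟ q′) (mass π a)
          ≈⟨ ∑-single (λ x → indicator (δ Γ q x Fin.≟ q′) (mass π x)) a
               (λ x x≢a → indicator-no (δ Γ q x Fin.≟ q′)
                 (λ δ≡q′ → q′≢⊙ (≡.trans (≡.sym δ≡q′) (falls x≢a)))) ⟨
        weightTo Γ π q q′ ∎
        where
        leaves : δ Γ q a ≢ sink Γ
        leaves = δ-compatible-≢sink Γ reach standard q≢⊙ (subst (All (_≡ a)) (≡.sym eq) (just ≡.refl))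

        falls : ∀ {x} → x ≢ a → δ Γ q x ≡ sink Γ
        falls = δ-incompatible-≡sink Γ reach standard compatible q≢⊙ eq

        off : ∀ x → x ≢ a → indicator (δ Γ q x Fin.≟ q′) (mass (point a) x) ≈ 0#
        off x x≢a = F.trans (indicator-cong (δ Γ q x Fin.≟ q′) (indicator-no (x Fin.≟ a) x≢a))
                            (indicator-zero (δ Γ q x Fin.≟ q′))

theorem3 : ∀ {c ℓ₁ ℓ₂ : Level} (𝔽 : OrderedField c ℓ₁ ℓ₂) →
    let open OrderedField 𝔽 in let open Models 𝔽 in
    ∀ {σ ℓ k : ℕ} (w : Word σ ℓ) (Γ : MatchingMachine w (Fin k)) →
    AllReachable Γ →
    (π : Distribution σ) →
    (¬ Redundant Γ →
    ∃[ M ] StatesFollow Γ π M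
    × StartsAtInitial Γ M
    × (∀ q q' → δ-M M q q' ≈ weightTo Γ π q q'))
    ×
    (Standard Γ → SinkCompatible Γ →
    ∃[ M ] StatesFollow Γ π M
    × StartsAtInitial Γ M
    × (∀ q q' → q' ≢ sink Γ → ¬ (weightOffSink Γ π q ≈ 0#) →
    δ-M M q q' ≈ weightTo Γ π q q' ÷ weightOffSink Γ π q))
theorem3 𝔽 w Γ reach π =
  (λ nonredundant →
     let letter-spec = nonredundant-memory Γ nonredundant in
     -- Every access is to an unread position, so each letter has law `π` and the transition formula
     -- holds by definition.
     model 𝔽 Γ π (const nothing) letter-spec ,
     statesFollow 𝔽 Γ π (const nothing) letter-spec ,
     (λ q → F.refl) ,
     (λ q q′ → F.refl)) ,
  (λ standard compatible →
     let letter      = canonicalLetter Γ reach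
         letter-spec = standard-memory Γ reach standard in
     model 𝔽 Γ π letter letter-spec ,
     statesFollow 𝔽 Γ π letter letter-spec ,
     (λ q → F.refl) ,
     (λ q q′ q′≢⊙ w≉0 →
        ÷-unique 𝔽 w≉0
          (transition-weight 𝔽 Γ π reach standard compatible q q′
            (≢sink 𝔽 Γ π reach standard compatible w≉0) q′≢⊙ (letter q) ≡.refl)))
  where module F = OrderedField 𝔽
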